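{- Let $G$ be a finite simple graph with nonempty vertex set. Then the circular altitude of $G$ equals the maximum of the circular altitudes of its blocks, i.e. $\alpha^o(G)=\max\{\alpha^o(B) \mid B \text{ is a block of } G\}$.
   Context: All graphs are simple, with finite and nonempty vertex set; $V(G)$ and $E(G)$ denote the vertex set and edge set of $G$. Circular altitude: a linear ordering of $V(G)$ is a bijection $\mathcal{U}:\{1,2,\ldots,|V(G)|\}\to V(G)$; write $u_i=\mathcal{U}(i)$. A $\mathcal{U}$-monotonic cycle of length $m$ ($m\ge 1$) is a sequence $u_{i_1},u_{i_2},\ldots,u_{i_m}$ of $m$ pairwise distinct vertices of $G$ such that, whenever $m>1$: (i) $i_1<i_2<\cdots<i_m$; (ii) $u_{i_t}$ and $u_{i_{t+1}}$ are adjacent for each $1\le t\le m-1$; (iii) $u_{i_m}$ and $u_{i_1}$ are adjacent. (So a single vertex is a monotonic cycle of length $1$, and an edge gives one of length $2$.) Let $|\mathcal{U}|$ denote the maximum length of a $\mathcal{U}$-monotonic cycle. The circular altitude $\alpha^o(G)$ is the minimum of $|\mathcal{U}|$ over all linear orderings $\mathcal{U}$ of $V(G)$. Blocks: a cut-vertex of a graph is a vertex whose removal results in a graph with a higher number of connected components. A graph is nonseparable if it is connected and has no cut-vertices. A block of $G$ is a maximal nonseparable subgraph of $G$, i.e. a nonseparable subgraph of $G$ that is not a subgraph of another nonseparable subgraph of $G$. -}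

module Defs where

open import Data.Fin using (Fin; zero; suc; inject₁; fromℕ)
import Data.Fin as Fin
open import Data.Fin.Properties using (_≟_)
open import Data.Fin.Subset using (Subset; _∈_; _⊆_; _-_; ∣_∣; Nonempty)
open import Data.Fin.Subset.Properties using (x∈p∧x≢y⇒x∈p-y)
open import Data.Nat using (ℕ; zero; suc; _≤_; _<_)
open import Data.Product using (∃; ∃-syntax; ∃₂; _×_; _,_; proj₁)
open import Data.Empty using (⊥)
open import Function.Bundles using (Bijection; _⤖_)
open import Function.Definitions using (Injective)
open import Level using (Level; 0ℓ)
open import Relation.Binary.Bundles using (Setoid)
open import Relation.Binary.Construct.Closure.ReflexiveTransitive
  using (Star; ε; _◅◅_; reverse)
open import Relation.Binary.Core using (Rel)
open import Relation.Binary.Definitions using (Symmetric; Decidable)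
open import Relation.Binary.PropositionalEquality using (_≡_; _≢_)
import Relation.Binary.PropositionalEquality as ≡
open import Relation.Nullary using (¬_)
open import Relation.Nullary.Decidable using (_×-dec_; ¬?)

private
  variable
    n : ℕ
    ℓ : Level

-- The vertices form a subset of an ambient Fin n, so that a graph and its
-- subgraphs have the same type.  V may be empty here, because deleting the
-- only vertex of a graph must still give something whose components can be
-- counted; nonemptiness is required separately where it matters.
record Graph (n : ℕ) : Set₁ where
  infix 4 _~_
  field
    V        : Subset n
    _~_      : Rel (Fin n) 0ℓ
    ~-dec    : Decidable _~_
    ~-sym    : Symmetric _~_
    ~-irrefl : ∀ {u} → ¬ (u ~ u)
    ~⇒∈      : ∀ {u w} → u ~ w → u ∈ V

  Vertex : Set
  Vertex = ∃[ u ] u ∈ V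

  order : ℕ
  order = ∣ V ∣

open Graph public using (V; Vertex; order)

Adj : (G : Graph n) → Rel (Fin n) 0ℓ
Adj = Graph._~_

infix 4 _⊑_

_⊑_ : Graph n → Graph n → Set
H ⊑ G = V H ⊆ V G × (∀ {u w} → Adj H u w → Adj G u w)

infixl 6 _∖_

_∖_ : Graph n → Fin n → Graph n
G ∖ v = record
  { V        = V G - v
  ; _~_      = λ u w → u ~ w × u ≢ v × w ≢ v
  ; ~-dec    = λ u w → ~-dec u w ×-dec ¬? (u ≟ v) ×-dec ¬? (w ≟ v)
  ; ~-sym    = λ (u~w , u≢v , w≢v) → ~-sym u~w , w≢v , u≢v
  ; ~-irrefl = λ (u~u , _) → ~-irrefl u~u
  ; ~⇒∈      = λ (u~w , u≢v , _) → x∈p∧x≢y⇒x∈p-y (~⇒∈ u~w) u≢v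
  }
  where open Graph G using (_~_; ~-dec; ~-sym; ~-irrefl; ~⇒∈)

Reachable : (G : Graph n) → Rel (Fin n) 0ℓ
Reachable G = Star (Adj G)

-- The quotient of the vertices by reachability, i.e. the set of components.
Components : Graph n → Setoid 0ℓ 0ℓ
Components G = record
  { Carrier       = Vertex G
  ; _≈_           = λ u w → Reachable G (proj₁ u) (proj₁ w)
  ; isEquivalence = record
    { refl  = ε
    ; sym   = reverse (Graph.~-sym G)
    ; trans = _◅◅_
    }
  }

HasComponentCount : Graph n → ℕ → Set
HasComponentCount G k = Bijection (Components G) (≡.setoid (Fin k))

Connected : Graph n → Set
Connected G = Nonempty (V G) × (∀ {u w} → u ∈ V G → w ∈ V G → Reachable G u w)

CutVertex : Graph n → Fin n → Set
CutVertex G v = v ∈ V G ×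
  ∃₂ λ k l → HasComponentCount G k × HasComponentCount (G ∖ v) l × k < l

Nonseparable : Graph n → Set
Nonseparable G = Connected G × (∀ v → ¬ CutVertex G v)

record IsBlock {n} (G B : Graph n) : Set₁ where
  field
    subgraph     : B ⊑ G
    nonseparable : Nonseparable B
    maximal      : ∀ C → C ⊑ G → Nonseparable C → B ⊑ C → C ⊑ B

IsMaximum : (ℕ → Set ℓ) → ℕ → Set ℓ
IsMaximum P m = P m × (∀ {k} → P k → k ≤ m)

IsMinimum : (ℕ → Set ℓ) → ℕ → Set ℓ
IsMinimum P m = P m × (∀ {k} → P k → m ≤ k)

-- Positions are 0, …, order G ∸ 1 rather than 1, …, order G.
LinearOrdering : Graph n → Set
LinearOrdering G = Fin (order G) ⤖ Vertex G

module _ (G : Graph n) (U : LinearOrdering G) where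

  vertexAt : Fin (order G) → Fin n
  vertexAt p = proj₁ (Bijection.to U p)

  -- A cycle of length suc m, given by the positions of its vertices.
  record IsMonotonicCycle {m} (i : Fin (suc m) → Fin (order G)) : Set where
    field
      distinct   : Injective _≡_ _≡_ (λ t → vertexAt (i t))
      increasing : 1 < suc m → ∀ {s t} → s Fin.< t → i s Fin.< i t
      adjacent   : 1 < suc m → ∀ (t : Fin m) →
                   Adj G (vertexAt (i (inject₁ t))) (vertexAt (i (suc t)))
      closing    : 1 < suc m → Adj G (vertexAt (i (fromℕ m))) (vertexAt (i zero))

  HasMonotonicCycle : ℕ → Set
  HasMonotonicCycle zero    = ⊥
  HasMonotonicCycle (suc m) = ∃[ i ] IsMonotonicCycle {m} i

-- HasWidth G U m says that |U| = m.
HasWidth : (G : Graph n) → LinearOrdering G → ℕ → Set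
HasWidth G U = IsMaximum (HasMonotonicCycle G U)

-- HasCircularAltitude G a says that α°(G) = a.  It is a relation because α° is
-- defined through a maximum and a minimum; a is unique since ≤ is antisymmetric.
HasCircularAltitude : Graph n → ℕ → Set
HasCircularAltitude G = IsMinimum (λ m → ∃[ U ] HasWidth G U m)

HasBlockOfAltitude : Graph n → ℕ → Set₁
HasBlockOfAltitude G b = ∃[ B ] (IsBlock G B × HasCircularAltitude B b)

-- A subgraph inherits an ordering, and with it at most the monotonic cycles of
-- the whole graph, so α° is monotone under taking subgraphs.  Conversely, if two
-- parts of a graph meet in at most one vertex v, then orderings of the parts can
-- be merged into one that extends both; a monotonic cycle passes through v at
-- most once and hence stays in one part.  Splitting at cut-vertices therefore
-- leads to a nonseparable subgraph whose altitude is at least that of G, and it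
-- lies in a block.
module Submission where

open import Defs
open import Data.Fin
  using (Fin; zero; suc; toℕ; fromℕ; fromℕ<; inject₁; finToFun; funToFin)
import Data.Fin as Fin
open import Data.Fin.Properties as Finₚ
  using (_≟_; any?; all?; toℕ-injective; toℕ-fromℕ<; toℕ<n;
         punchOut-injective; injective⇒≤; <⇒notInjective; finToFun-funToFin)
open import Data.Fin.Subset
  using (Subset; inside; outside; _∈_; _∉_; _⊆_; _∩_; _-_; ∣_∣; Nonempty)
open import Data.Fin.Subset.Properties
  using (_∈?_; _⊆?_; _⊂?_; anySubset?; ∣p∣≤n; p⊆q⇒∣p∣≤∣q∣; p⊂q⇒∣p∣<∣q∣; p─q⊆p;
         x∈p∧x≢y⇒x∈p-y; x∈p∩q⁺; x∈p∩q⁻)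
open import Data.List.Base using (List; []; _∷_; allFin)
open import Data.List.Membership.Propositional using () renaming (_∈_ to _∈ˡ_)
open import Data.List.Membership.Propositional.Properties using (∈-allFin)
open import Data.List.Relation.Unary.Any using (here; there)
open import Data.Nat
  using (ℕ; zero; suc; _+_; _*_; _∸_; _≤_; _<_; z≤n; s≤s; z<s; s≤s⁻¹; s<s⁻¹; _<?_)
import Data.Nat as ℕ
open import Data.Nat.Induction using (<-wellFounded)
import Data.Nat.Properties as ℕₚ
open import Data.Product using (∃; ∃-syntax; ∃₂; Σ; _×_; _,_; proj₁; proj₂)
open import Data.Sum using (_⊎_; inj₁; inj₂; [_,_]′)
import Data.Sum as Sum
open import Data.Vec using (_∷_; tabulate; here; there)
open import Data.Vec.Properties using ([]=⇒lookup; lookup⇒[]=; lookup∘tabulate)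
open import Data.Vec.Properties.WithK using ([]=-irrelevant)
open import Function using (_∘_; id)
open import Function.Bundles using (Bijection; mk⤖)
open import Function.Definitions using (Injective)
open import Induction.WellFounded using (Acc; acc)
open import Level using (0ℓ)
open import Relation.Binary.Construct.Closure.ReflexiveTransitive
  using (Star; ε; _◅_; _◅◅_; reverse; return)
import Relation.Binary.Construct.Closure.ReflexiveTransitive as Star
open import Relation.Binary.Core using (Rel)
import Relation.Binary.Definitions as B
open import Relation.Binary.Definitions using (tri<; tri≈; tri>)
open import Relation.Binary.PropositionalEquality
open import Relation.Nullary using (¬_; Dec; yes; no; does; contradiction)
open import Relation.Nullary.Decidable
  using (map′; _×-dec_; _⊎-dec_; _→-dec_; ¬?; dec-true; decidable-stable)
open import Relation.Unary using (Pred; Decidable)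

-- An ordering is handled as a numbering `r : Fin n → ℕ` that is injective on the vertices: a
-- subgraph reuses the same `r`, and gaps between values leave room for merging two numberings. The
-- maximum and the minimum behind α° must be shown to exist constructively. Hence `Altitude≤ G k` is
-- proved decidable, and its least `k` turns out to be the exact width of an ordering.
-- `Nonseparable` speaks of component counts, which are awkward to search with. It is traded for
-- connectivity after deletion of any one vertex, which is decidable, so that cut-vertices and
-- maximal vertex sets can be found by search.

private
  variable
    n : ℕ

-- Finite subsets and the pigeonhole principle

module _ {P : Pred (Fin n) 0ℓ} (P? : Decidable P) where

  setOf : Subset n
  setOf = tabulate (does ∘ P?)

  ∈-setOf⁺ : ∀ {x} → P x → x ∈ setOf
  ∈-setOf⁺ {x} px =
    lookup⇒[]= x setOf (trans (lookup∘tabulate _ x) (dec-true (P? x) px))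

  ∈-setOf⁻ : ∀ {x} → x ∈ setOf → P x
  ∈-setOf⁻ {x} x∈ with P? x | trans (sym (lookup∘tabulate (does ∘ P?) x)) ([]=⇒lookup x∈)
  ... | yes px | _ = px
  ... | no  _  | ()

element : (p : Subset n) → Fin ∣ p ∣ → Fin n
element (inside  ∷ p) zero    = zero
element (inside  ∷ p) (suc i) = suc (element p i)
element (outside ∷ p) i       = suc (element p i)

element∈ : (p : Subset n) (i : Fin ∣ p ∣) → element p i ∈ p
element∈ (inside  ∷ p) zero    = here
element∈ (inside  ∷ p) (suc i) = there (element∈ p i)
element∈ (outside ∷ p) i       = there (element∈ p i)

element-injective : (p : Subset n) → Injective _≡_ _≡_ (element p)
element-injective (inside  ∷ p) {zero}  {zero}  _  = refl
element-injective (inside  ∷ p) {suc i} {suc j} eq =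
  cong suc (element-injective p (Finₚ.suc-injective eq))
element-injective (outside ∷ p) eq = element-injective p (Finₚ.suc-injective eq)

element-surjective : (p : Subset n) → ∀ {x} → x ∈ p → ∃[ i ] element p i ≡ x
element-surjective (inside  ∷ p) here       = zero , refl
element-surjective (inside  ∷ p) (there x∈) =
  let i , eq = element-surjective p x∈ in suc i , cong suc eq
element-surjective (outside ∷ p) (there x∈) =
  let i , eq = element-surjective p x∈ in i , cong suc eq

-∈⁻ : ∀ (p : Subset n) {x y} → x ∈ p - y → x ∈ p × x ≢ y
-∈⁻ (inside  ∷ p) {zero}  {suc y} here       = here , λ ()
-∈⁻ (inside  ∷ p) {suc x} {zero}  (there x∈) = there (p─q⊆p p _ x∈) , λ ()
-∈⁻ (outside ∷ p) {suc x} {zero}  (there x∈) = there (p─q⊆p p _ x∈) , λ ()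
-∈⁻ (s       ∷ p) {suc x} {suc y} (there x∈) =
  let x∈p , x≢y = -∈⁻ p x∈ in there x∈p , x≢y ∘ Finₚ.suc-injective

injective⇒surjective : ∀ {m} {f : Fin m → Fin m} → Injective _≡_ _≡_ f →
                       ∀ y → ∃[ x ] f x ≡ y
injective⇒surjective {suc m} {f} inj y with any? (λ x → f x ≟ y)
... | yes hit  = hit
... | no  ¬hit = contradiction
  (λ {x} {z} eq → inj (punchOut-injective (missed x) (missed z) eq))
  (<⇒notInjective (ℕₚ.n<1+n m))
  where
  missed : ∀ x → y ≢ f x
  missed x y≡fx = ¬hit (x , sym y≡fx)

-- Reachability

module _ {R : Rel (Fin n) 0ℓ} (R? : B.Decidable R) where

  -- Warshall's algorithm: the inner vertices of the walk are taken from the list.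
  Via : List (Fin n) → Rel (Fin n) 0ℓ
  Via []       u w = u ≡ w ⊎ R u w
  Via (x ∷ xs) u w = Via xs u w ⊎ (Via xs u x × Via xs x w)

  via? : ∀ xs → B.Decidable (Via xs)
  via? []       u w = u ≟ w ⊎-dec R? u w
  via? (x ∷ xs) u w = via? xs u w ⊎-dec (via? xs u x ×-dec via? xs x w)

  via-base : ∀ xs {u w} → u ≡ w ⊎ R u w → Via xs u w
  via-base []       = id
  via-base (x ∷ xs) = inj₁ ∘ via-base xs

  via-trans : ∀ xs {u z w} → z ∈ˡ xs → Via xs u z → Via xs z w → Via xs u w
  via-trans (x ∷ xs) (here refl) p q = inj₂ ([ id , proj₁ ]′ p , [ id , proj₂ ]′ q)
  via-trans (x ∷ xs) (there z∈) (inj₁ p)       (inj₁ q)       = inj₁ (via-trans xs z∈ p q)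
  via-trans (x ∷ xs) (there z∈) (inj₁ p)       (inj₂ (q , s)) = inj₂ (via-trans xs z∈ p q , s)
  via-trans (x ∷ xs) (there z∈) (inj₂ (p , t)) (inj₁ q)       = inj₂ (p , via-trans xs z∈ t q)
  -- Both legs visit `x`, so the loop from `x` through `z` back to `x` is cut out.
  via-trans (x ∷ xs) (there z∈) (inj₂ (p , _)) (inj₂ (_ , s)) = inj₂ (p , s)

  via⇒star : ∀ xs {u w} → Via xs u w → Star R u w
  via⇒star []       (inj₁ refl)    = ε
  via⇒star []       (inj₂ r)       = return r
  via⇒star (x ∷ xs) (inj₁ p)       = via⇒star xs p
  via⇒star (x ∷ xs) (inj₂ (p , q)) = via⇒star xs p ◅◅ via⇒star xs q

  star⇒via : ∀ {u w} → Star R u w → Via (allFin n) u w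
  star⇒via ε        = via-base (allFin n) (inj₁ refl)
  star⇒via (r ◅ rs) =
    via-trans (allFin n) (∈-allFin _) (via-base (allFin n) (inj₂ r)) (star⇒via rs)

  star? : B.Decidable (Star R)
  star? u w = map′ (via⇒star (allFin n)) star⇒via (via? (allFin n) u w)

reachable? : (G : Graph n) → B.Decidable (Reachable G)
reachable? G = star? (Graph.~-dec G)

⊑-trans : (G H K : Graph n) → G ⊑ H → H ⊑ K → G ⊑ K
⊑-trans _ _ _ (v , a) (v′ , a′) = v′ ∘ v , a′ ∘ a

reachable-mono : (H G : Graph n) → H ⊑ G → ∀ {u w} → Reachable H u w → Reachable G u w
reachable-mono _ _ (_ , adj) = Star.map adj

∖-⊑ : (G : Graph n) (v : Fin n) → G ∖ v ⊑ G
∖-⊑ G v = proj₁ ∘ -∈⁻ (V G) , proj₁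

module _ (G : Graph n) where
  open Graph G using (~⇒∈; ~-sym)

  reachable⇒∈ : ∀ {u w} → Reachable G u w → w ∈ V G → u ∈ V G
  reachable⇒∈ ε       w∈ = w∈
  reachable⇒∈ (e ◅ _) _  = ~⇒∈ e

  private
    Leader : Fin n → Set
    Leader x = x ∈ V G × (∀ y → y Fin.< x → ¬ Reachable G y x)

    leader? : Decidable Leader
    leader? x = x ∈? V G ×-dec all? λ y → y Finₚ.<? x →-dec ¬? (reachable? G y x)

    leaders : Subset n
    leaders = setOf leader?

    leader-of : ∀ x → Acc _<_ (toℕ x) → x ∈ V G → ∃[ y ] Leader y × Reachable G x y
    leader-of x (acc rec) x∈
      with any? (λ y → y Finₚ.<? x ×-dec reachable? G y x)
    ... | no  none = x , (x∈ , λ y y<x r → none (y , y<x , r)) , ε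
    ... | yes (y , y<x , r) =
      let z , lz , s = leader-of y (rec y<x) (reachable⇒∈ r x∈)
      in  z , lz , reverse ~-sym r ◅◅ s

    leader-unique : ∀ {x y} → Leader x → Leader y → Reachable G x y → x ≡ y
    leader-unique {x} {y} (_ , lx) (_ , ly) r with Finₚ.<-cmp x y
    ... | tri< x<y _ _ = contradiction r (ly x x<y)
    ... | tri≈ _ x≡y _ = x≡y
    ... | tri> _ _ y<x = contradiction (reverse ~-sym r) (lx y y<x)

    index : (x : Vertex G) → ∃[ i ] Reachable G (proj₁ x) (element leaders i)
    index (x , x∈) with leader-of x (<-wellFounded _) x∈
    ... | y , ly , r with element-surjective leaders (∈-setOf⁺ leader? ly)
    ...   | i , refl = i , r

    index-unique : ∀ {i j} → Reachable G (element leaders i) (element leaders j) → i ≡ j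
    index-unique {i} {j} r = element-injective leaders (leader-unique
      (∈-setOf⁻ leader? (element∈ leaders i)) (∈-setOf⁻ leader? (element∈ leaders j)) r)

  -- Every component has exactly one least vertex, its leader, so the leaders can be counted
  -- instead. An explicit count is what a proof of `CutVertex` has to exhibit.
  component-count : ∃[ k ] HasComponentCount G k
  component-count = ∣ leaders ∣ , record
    { to        = proj₁ ∘ index
    ; cong      = λ {x} {y} r → index-unique
                    (reverse ~-sym (proj₂ (index x)) ◅◅ r ◅◅ proj₂ (index y))
    ; bijective =
        (λ {x} {y} eq → proj₂ (index x) ◅◅
           subst (λ i → Reachable G (element leaders i) (proj₁ y)) (sym eq)
             (reverse ~-sym (proj₂ (index y))))
      , λ i → (element leaders i , proj₁ (∈-setOf⁻ leader? (element∈ leaders i)))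
            , λ {z} r → sym (index-unique (reverse ~-sym r ◅◅ proj₂ (index z)))
    }

-- Nonseparable graphs

Preconnected : Graph n → Set
Preconnected G = ∀ {u w} → u ∈ V G → w ∈ V G → Reachable G u w

Disconnection : Graph n → Set
Disconnection G = ∃₂ λ u w → u ∈ V G × w ∈ V G × ¬ Reachable G u w

disconnection? : Decidable (Disconnection {n})
disconnection? G = any? λ u → any? λ w →
  u ∈? V G ×-dec w ∈? V G ×-dec ¬? (reachable? G u w)

¬disconnection⇒preconnected : (G : Graph n) → ¬ Disconnection G → Preconnected G
¬disconnection⇒preconnected G ¬d {u} {w} u∈ w∈ =
  decidable-stable (reachable? G u w) λ ¬r → ¬d (u , w , u∈ , w∈ , ¬r)

-- Nonseparability without component counts. The empty graph satisfies it too, so nonemptiness is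
-- carried alongside.
Biconnected : Graph n → Set
Biconnected G = Preconnected G × (∀ v → v ∈ V G → Preconnected (G ∖ v))

biconnected-or-cut : (G : Graph n) →
  Biconnected G ⊎ (Disconnection G ⊎ ∃[ v ] v ∈ V G × Disconnection (G ∖ v))
biconnected-or-cut G
  with disconnection? G | any? (λ v → v ∈? V G ×-dec disconnection? (G ∖ v))
... | yes d | _     = inj₂ (inj₁ d)
... | no  _ | yes c = inj₂ (inj₂ c)
... | no ¬d | no ¬c = inj₁ (¬disconnection⇒preconnected G ¬d ,
  λ v v∈ → ¬disconnection⇒preconnected (G ∖ v) λ d → ¬c (v , v∈ , d))

biconnected? : Decidable (Biconnected {n})
biconnected? G with biconnected-or-cut G
... | inj₁ b = yes b
... | inj₂ (inj₁ (_ , _ , u∈ , w∈ , ¬r)) = no λ (p , _) → ¬r (p u∈ w∈)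
... | inj₂ (inj₂ (v , v∈ , _ , _ , u∈ , w∈ , ¬r)) = no λ (_ , p) → ¬r (p v v∈ u∈ w∈)

biconnected⇒nonseparable : (G : Graph n) → Nonempty (V G) → Biconnected G → Nonseparable G
biconnected⇒nonseparable G ne@(u₀ , u₀∈) (p , q) =
  (ne , p) , λ v (v∈ , k , l , kc , lc , k<l) → nocut v v∈ k l kc lc k<l
  where
  nocut : ∀ v → v ∈ V G → ∀ k l → HasComponentCount G k → HasComponentCount (G ∖ v) l → ¬ k < l
  nocut v v∈ zero    l             kc lc _ = contradiction (Bijection.to kc (u₀ , u₀∈)) Finₚ.¬Fin0
  nocut v v∈ (suc k) (suc zero)    kc lc (s≤s ())
  -- Representatives of two different components of the graph without `v` are joined by a walk
  -- avoiding `v`, so their component numbers would coincide.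
  nocut v v∈ (suc k) (suc (suc l)) kc lc _
    with (x , x∈) , x↦ ← Bijection.surjective lc zero
       | (y , y∈) , y↦ ← Bijection.surjective lc (suc zero)
    with () ← trans (sym (x↦ {x , x∈} ε))
                   (trans (Bijection.cong lc (q v v∈ x∈ y∈)) (y↦ {y , y∈} ε))

nonseparable⇒biconnected : (G : Graph n) → Nonseparable G → Biconnected G
nonseparable⇒biconnected G ((ne , p) , nocut) = p , λ v v∈ →
  ¬disconnection⇒preconnected (G ∖ v) (nocut v ∘ cut v∈)
  where
  one : HasComponentCount G 1
  one = record
    { to = λ _ → zero ; cong = λ _ → refl
    ; bijective = (λ {x} {y} _ → p (proj₂ x) (proj₂ y)) , λ { zero → ne , λ _ → refl } }

  1<count : ∀ {v l} → HasComponentCount (G ∖ v) l → Disconnection (G ∖ v) → 1 < l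
  1<count {l = zero}        lc (u , w , u∈ , w∈ , ¬r) =
    contradiction (Bijection.to lc (u , u∈)) Finₚ.¬Fin0
  1<count {l = suc (suc l)} lc _ = s≤s (s≤s z≤n)
  1<count {l = suc zero}    lc (u , w , u∈ , w∈ , ¬r)
    with Bijection.to lc (u , u∈) in eq | Bijection.to lc (w , w∈) in eq′
  ... | zero | zero = contradiction (Bijection.injective lc (trans eq (sym eq′))) ¬r

  cut : ∀ {v} → v ∈ V G → Disconnection (G ∖ v) → CutVertex G v
  cut {v} v∈ d = let l , lc = component-count (G ∖ v) in v∈ , 1 , l , one , lc , 1<count lc d

-- Walks survive the addition of edges. This allows a nonseparable subgraph to be replaced by the
-- induced subgraph on its vertices.
biconnected-spanning : (H G : Graph n) → H ⊑ G → V G ⊆ V H → Biconnected H → Biconnected G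
biconnected-spanning H G H⊑G G⊆H (p , q) =
    (λ u∈ w∈ → reachable-mono H G H⊑G (p (G⊆H u∈) (G⊆H w∈)))
  , λ v v∈ u∈ w∈ → reachable-mono (H ∖ v) (G ∖ v)
      ((λ x∈ → let x∈H , x≢v = -∈⁻ (V H) x∈ in x∈p∧x≢y⇒x∈p-y (proj₁ H⊑G x∈H) x≢v)
      , λ (e , x≢v , y≢v) → proj₂ H⊑G e , x≢v , y≢v)
      (q v (G⊆H v∈) (shrink v u∈) (shrink v w∈))
  where
  shrink : ∀ v {x} → x ∈ V G - v → x ∈ V H - v
  shrink v x∈ = let x∈G , x≢v = -∈⁻ (V G) x∈ in x∈p∧x≢y⇒x∈p-y (G⊆H x∈G) x≢v

-- Monotonic cycles with respect to a numbering of the vertices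

InjectiveOn : Subset n → (Fin n → ℕ) → Set
InjectiveOn p r = ∀ {x y} → x ∈ p → y ∈ p → r x ≡ r y → x ≡ y

OrderPreserving : Subset n → (r s : Fin n → ℕ) → Set
OrderPreserving p r s = ∀ {x y} → x ∈ p → y ∈ p → r x < r y → s x < s y

data Path (G : Graph n) (r : Fin n → ℕ) : Fin n → Fin n → ℕ → Set where
  single : ∀ {u} → u ∈ V G → Path G r u u 0
  step   : ∀ {u z w m} → Adj G u z → r u < r z → Path G r z w m → Path G r u w (suc m)

-- The index m of a path or cycle is the number of vertices minus one.
Cycle : Graph n → (Fin n → ℕ) → ℕ → Set
Cycle G r m = ∃₂ λ u w → Path G r u w m × (0 < m → Adj G w u)

Width≤ : Graph n → (Fin n → ℕ) → ℕ → Set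
Width≤ G r k = ∀ {m} → Cycle G r m → m < k

Altitude≤ : Graph n → ℕ → Set
Altitude≤ G k = ∃[ r ] InjectiveOn (V G) r × Width≤ G r k

module _ {G : Graph n} where
  open Graph G using (~⇒∈; ~-sym)

  path-start∈ : ∀ {r u w m} → Path G r u w m → u ∈ V G
  path-start∈ (single u∈)  = u∈
  path-start∈ (step e _ _) = ~⇒∈ e

  path-map : ∀ {H : Graph n} {r s} → G ⊑ H → OrderPreserving (V G) r s →
             ∀ {u w m} → Path G r u w m → Path H s u w m
  path-map G⊑H r⇒s (single u∈)   = single (proj₁ G⊑H u∈)
  path-map G⊑H r⇒s (step e lt p) =
    step (proj₂ G⊑H e) (r⇒s (~⇒∈ e) (~⇒∈ (~-sym e)) lt) (path-map G⊑H r⇒s p)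

  cycle-map : ∀ {H : Graph n} {r s} → G ⊑ H → OrderPreserving (V G) r s →
              ∀ {m} → Cycle G r m → Cycle H s m
  cycle-map G⊑H r⇒s (u , w , p , closing) = u , w , path-map G⊑H r⇒s p , proj₂ G⊑H ∘ closing

  vertex : ∀ {r u w m} → Path G r u w m → Fin (suc m) → Fin n
  vertex {u = u} p            zero    = u
  vertex         (step _ _ p) (suc t) = vertex p t

  vertex-last : ∀ {r u w m} (p : Path G r u w m) → vertex p (fromℕ m) ≡ w
  vertex-last (single _)   = refl
  vertex-last (step _ _ p) = vertex-last p

  vertex∈ : ∀ {r u w m} (p : Path G r u w m) t → vertex p t ∈ V G
  vertex∈ p            zero    = path-start∈ p
  vertex∈ (step _ _ p) (suc t) = vertex∈ p t

  vertex-adjacent : ∀ {r u w m} (p : Path G r u w m) (t : Fin m) →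
                    Adj G (vertex p (inject₁ t)) (vertex p (suc t))
  vertex-adjacent (step e _ p) zero    = e
  vertex-adjacent (step _ _ p) (suc t) = vertex-adjacent p t

  vertex-increasing : ∀ {r u w m} (p : Path G r u w m) {s t} → s Fin.< t →
                      r (vertex p s) < r (vertex p t)
  vertex-increasing (step _ lt p) {zero}  {suc zero}    _   = lt
  vertex-increasing (step _ lt p) {zero}  {suc (suc t)} _   =
    ℕₚ.<-trans lt (vertex-increasing p {zero} {suc t} z<s)
  vertex-increasing (step _ _ p)  {suc s} {suc t}       s<t = vertex-increasing p (s<s⁻¹ s<t)

  vertex-injective : ∀ {r u w m} (p : Path G r u w m) → Injective _≡_ _≡_ (vertex p)
  vertex-injective {r} p {s} {t} eq with Finₚ.<-cmp s t
  ... | tri< s<t _ _ = contradiction (cong r eq) (ℕₚ.<⇒≢ (vertex-increasing p s<t))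
  ... | tri≈ _ s≡t _ = s≡t
  ... | tri> _ _ t<s = contradiction (cong r (sym eq)) (ℕₚ.<⇒≢ (vertex-increasing p t<s))

  cycle-length : ∀ {r m} → Cycle G r m → m < n
  cycle-length (_ , _ , p , _) = injective⇒≤ (vertex-injective p)

  path-tabulate : ∀ {r} m (f : Fin (suc m) → Fin n) → (∀ t → f t ∈ V G) →
    (∀ (t : Fin m) → Adj G (f (inject₁ t)) (f (suc t))) →
    (∀ (t : Fin m) → r (f (inject₁ t)) < r (f (suc t))) →
    Path G r (f zero) (f (fromℕ m)) m
  path-tabulate zero    f f∈ adj inc = single (f∈ zero)
  path-tabulate (suc m) f f∈ adj inc = step (adj zero) (inc zero)
    (path-tabulate m (f ∘ suc) (f∈ ∘ suc) (adj ∘ suc) (inc ∘ suc))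

-- Deciding a bound on the altitude

module _ (G : Graph n) where
  open Graph G using (~-dec)

  path? : ∀ r u w m → Dec (Path G r u w m)
  path? r u w zero with u ≟ w | u ∈? V G
  ... | no u≢w   | _      = no λ { (single _) → u≢w refl }
  ... | yes refl | yes u∈ = yes (single u∈)
  ... | yes refl | no u∉  = no λ { (single u∈) → u∉ u∈ }
  path? r u w (suc m) = map′
    (λ (_ , e , lt , p) → step e lt p) (λ { (step e lt p) → _ , e , lt , p })
    (any? λ z → ~-dec u z ×-dec r u <? r z ×-dec path? r z w m)

  cycle? : ∀ r m → Dec (Cycle G r m)
  cycle? r m = any? λ u → any? λ w → path? r u w m ×-dec (0 <? m →-dec ~-dec w u)

  -- A cycle has at most `n` vertices, so the quantifier over all lengths reduces to one over
  -- `Fin n`.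
  width≤? : ∀ r k → Dec (Width≤ G r k)
  width≤? r k = map′
    (λ short {m} c → subst (_< k) (toℕ-fromℕ< (cycle-length c))
      (short (fromℕ< (cycle-length c))
        (subst (Cycle G r) (sym (toℕ-fromℕ< (cycle-length c))) c)))
    (λ short m c → short c)
    (all? λ (m : Fin n) → cycle? r (toℕ m) →-dec toℕ m <? k)

  injectiveOn? : ∀ r → Dec (InjectiveOn (V G) r)
  injectiveOn? r = map′ (λ inj {x} {y} → inj x y) (λ inj x y → inj)
    (all? λ x → all? λ y → x ∈? V G →-dec y ∈? V G →-dec r x ℕ.≟ r y →-dec x ≟ y)

module _ (G : Graph n) (r : Fin n → ℕ) where

  private
    below? : ∀ u → Decidable λ w → w ∈ V G × r w < r u
    below? u w = w ∈? V G ×-dec r w <? r u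

  below : Fin n → Subset n
  below u = setOf (below? u)

  -- For a vertex, this is its position when the vertices are sorted by `r`. Being a cardinality, it
  -- is at most `n` however large the values of `r` are.
  rank : Fin n → ℕ
  rank u = ∣ below u ∣

  rank-mono-≤ : ∀ {u w} → r u ≤ r w → rank u ≤ rank w
  rank-mono-≤ {u} {w} u≤w = p⊆q⇒∣p∣≤∣q∣ λ x∈ →
    let x∈V , x<u = ∈-setOf⁻ (below? u) x∈ in ∈-setOf⁺ (below? w) (x∈V , ℕₚ.<-≤-trans x<u u≤w)

  rank-cancel-< : ∀ {u w} → rank u < rank w → r u < r w
  rank-cancel-< lt = ℕₚ.≰⇒> λ w≤u → ℕₚ.<⇒≱ lt (rank-mono-≤ w≤u)

  rank-mono-< : ∀ {u w} → u ∈ V G → r u < r w → rank u < rank w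
  rank-mono-< {u} {w} u∈ u<w = p⊂q⇒∣p∣<∣q∣
    ( (λ x∈ → let x∈V , x<u = ∈-setOf⁻ (below? u) x∈
                 in ∈-setOf⁺ (below? w) (x∈V , ℕₚ.<-trans x<u u<w))
    , u , ∈-setOf⁺ (below? w) (u∈ , u<w) , ℕₚ.<-irrefl refl ∘ proj₂ ∘ ∈-setOf⁻ (below? u))

  rank<order : ∀ {u} → u ∈ V G → rank u < order G
  rank<order {u} u∈ = p⊂q⇒∣p∣<∣q∣
    (proj₁ ∘ ∈-setOf⁻ (below? u) , u , u∈ , ℕₚ.<-irrefl refl ∘ proj₂ ∘ ∈-setOf⁻ (below? u))

  rank-injective : InjectiveOn (V G) r → InjectiveOn (V G) rank
  rank-injective inj {x} {y} x∈ y∈ eq with ℕₚ.<-cmp (r x) (r y)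
  ... | tri< x<y _ _ = contradiction eq (ℕₚ.<⇒≢ (rank-mono-< x∈ x<y))
  ... | tri≈ _ x≡y _ = inj x∈ y∈ x≡y
  ... | tri> _ _ y<x = contradiction (sym eq) (ℕₚ.<⇒≢ (rank-mono-< y∈ y<x))

-- There are infinitely many numberings, but replacing one by its ranks keeps injectivity and
-- creates no new monotonic cycles. Ranks are at most `n`, which leaves finitely many functions,
-- coded by `Fin (suc n ^ n)`.
altitude≤? : (G : Graph n) → Decidable (Altitude≤ G)
altitude≤? {n} G k = map′
  (λ (c , good) → numbering c , good)
  (λ (r , inj , short) →
    let s   = λ u → fromℕ< (s≤s (∣p∣≤n (below G r u)))
        eq  = λ u → trans (cong toℕ (finToFun-funToFin s u))
                          (toℕ-fromℕ< (s≤s (∣p∣≤n (below G r u))))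
    in  funToFin s
      , (λ {x} {y} x∈ y∈ sx≡sy →
          rank-injective G r inj x∈ y∈ (trans (sym (eq x)) (trans sx≡sy (eq y))))
      , (λ c → short (cycle-map {G = G} {G} (id , id)
          (λ {x} {y} _ _ lt → rank-cancel-< G r (subst₂ _<_ (eq x) (eq y) lt)) c)))
  (any? λ c → injectiveOn? G (numbering c) ×-dec width≤? G (numbering c) k)
  where
  numbering : Fin (suc n ℕ.^ n) → Fin n → ℕ
  numbering c u = toℕ (finToFun {suc n} {n} c u)

altitude-mono : (H G : Graph n) → H ⊑ G → ∀ {k} → Altitude≤ G k → Altitude≤ H k
altitude-mono H G H⊑G (r , inj , short) =
    r , (λ x∈ y∈ → inj (proj₁ H⊑G x∈) (proj₁ H⊑G y∈))
  , λ c → short (cycle-map {G = H} {G} {r} {r} H⊑G (λ _ _ → id) c)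

-- Separations

induced : Graph n → Subset n → Graph n
induced G S = record
  { V        = V G ∩ S
  ; _~_      = λ u w → u ~ w × u ∈ S × w ∈ S
  ; ~-dec    = λ u w → ~-dec u w ×-dec u ∈? S ×-dec w ∈? S
  ; ~-sym    = λ (e , u∈ , w∈) → ~-sym e , w∈ , u∈
  ; ~-irrefl = λ (e , _) → ~-irrefl e
  ; ~⇒∈      = λ (e , u∈ , _) → x∈p∩q⁺ (~⇒∈ e , u∈)
  }
  where open Graph G using (_~_; ~-dec; ~-sym; ~-irrefl; ~⇒∈)

induced-⊑ : (G : Graph n) (S : Subset n) → induced G S ⊑ G
induced-⊑ G S = proj₁ ∘ x∈p∩q⁻ (V G) S , proj₁

-- One notion for both reasons to split: at a cut-vertex the parts share `v`, in a disconnected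
-- graph they are disjoint and `v` is only a placeholder. The parts may contain elements outside
-- `V G`.
record Separation (G : Graph n) : Set where
  field
    S T     : Subset n
    v       : Fin n
    cover   : ∀ {x} → x ∈ V G → x ∈ S ⊎ x ∈ T
    meet : ∀ {x} → x ∈ S → x ∈ T → x ≡ v
    edge    : ∀ {x y} → Adj G x y → (x ∈ S × y ∈ S) ⊎ (x ∈ T × y ∈ T)

flip : {G : Graph n} → Separation G → Separation G
flip sep = record
  { S       = T
  ; T       = S
  ; v       = v
  ; cover   = Sum.swap ∘ cover
  ; meet = λ x∈T x∈S → meet x∈S x∈T
  ; edge    = Sum.swap ∘ edge
  }
  where open Separation sep

module _ {G : Graph n} {r : Fin n → ℕ} (sep : Separation G) where
  open Separation sep
  open Graph G using (~⇒∈; ~-sym)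

  -- An edge that enters `S` from outside lies in `T`, so it can only end at `v`; a path already
  -- numbered above `v` never gets back there.
  escape : ∀ {u w m} → r v < r u → u ∉ S → Path G r u w m → w ∉ S
  escape v<u u∉S (single _) = u∉S
  escape {u} v<u u∉S (step {z = z} e u<z p) = escape (ℕₚ.<-trans v<u u<z) z∉S p
    where
    z∉S : z ∉ S
    z∉S z∈S with edge e
    ... | inj₁ (u∈S , _) = u∉S u∈S
    ... | inj₂ (_ , z∈T) with refl ← meet z∈S z∈T = ℕₚ.<-asym v<u u<z

  module _ {s : Fin n → ℕ} (r⇒s : OrderPreserving (V G ∩ S) r s) where

    step-induced : ∀ {u z w m} → Adj G u z → u ∈ S → z ∈ S → r u < r z →
                   Path (induced G S) s z w m → Path (induced G S) s u w (suc m)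
    step-induced e u∈S z∈S u<z =
      step (e , u∈S , z∈S) (r⇒s (x∈p∩q⁺ (~⇒∈ e , u∈S)) (x∈p∩q⁺ (~⇒∈ (~-sym e) , z∈S)) u<z)

    confine-above : ∀ {u w m} → r v ≤ r u → u ∈ S → w ∈ S →
                    Path G r u w m → Path (induced G S) s u w m
    confine-above v≤u u∈S w∈S (single u∈) = single (x∈p∩q⁺ (u∈ , u∈S))
    confine-above v≤u u∈S w∈S (step {z = z} e u<z p) with z ∈? S
    ... | yes z∈S = step-induced e u∈S z∈S u<z
          (confine-above (ℕₚ.<⇒≤ (ℕₚ.≤-<-trans v≤u u<z)) z∈S w∈S p)
    ... | no  z∉S = contradiction w∈S (escape (ℕₚ.≤-<-trans v≤u u<z) z∉S p)

    -- A monotonic path passes through v only once, so it cannot leave S and come back.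
    confine : ∀ {u w m} → u ∈ S → w ∈ S → Path G r u w m → Path (induced G S) s u w m
    confine u∈S w∈S (single u∈) = single (x∈p∩q⁺ (u∈ , u∈S))
    confine {u} u∈S w∈S (step e u<z p) with u ≟ v | edge e
    -- Only at `v` may the path leave `S`; from here on all numbers are at least that of `v`, and
    -- `escape` rules out a return.
    ... | yes refl | _                = confine-above ℕₚ.≤-refl u∈S w∈S (step e u<z p)
    ... | no _     | inj₁ (_ , z∈S)   = step-induced e u∈S z∈S u<z (confine z∈S w∈S p)
    ... | no u≢v   | inj₂ (u∈T , z∈T) = contradiction (meet u∈S u∈T) u≢v

    confine-cycle : ∀ {u w m} → u ∈ S → w ∈ S → Path G r u w m → (0 < m → Adj G w u) →
                    Cycle (induced G S) s m
    confine-cycle u∈S w∈S p closing =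
      _ , _ , confine u∈S w∈S p , λ 0<m → closing 0<m , w∈S , u∈S

  -- The closing edge lies in one part and so puts both ends there; a single vertex is placed by
  -- `cover`.
  path-ends : ∀ {u w m} → Path G r u w m → (0 < m → Adj G w u) →
              (u ∈ S × w ∈ S) ⊎ (u ∈ T × w ∈ T)
  path-ends (single u∈) _       = Sum.map (λ x → x , x) (λ x → x , x) (cover u∈)
  path-ends (step _ _ _) closing = edge (~-sym (closing z<s))

-- Both numberings are shifted so that they agree at v; doubling makes room for
-- the vertices outside S at the odd numbers.
module _ {G : Graph n} (sep : Separation G) (r₁ r₂ : Fin n → ℕ) where
  open Separation sep

  merge : Fin n → ℕ
  merge x with x ∈? S
  ... | yes _ = 2 * (r₁ x + r₂ v)
  ... | no  _ = suc (2 * (r₂ x + r₁ v))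

  merge-S : ∀ {x} → x ∈ S → merge x ≡ 2 * (r₁ x + r₂ v)
  merge-S {x} x∈S with x ∈? S
  ... | yes _  = refl
  ... | no x∉S = contradiction x∈S x∉S

  double< : ∀ {a b} → suc (2 * a) < 2 * b → a < b
  double< {a} {b} lt = ℕₚ.*-cancelˡ-< 2 a b (ℕₚ.<-trans (ℕₚ.n<1+n (2 * a)) lt)

  merge-preserves₁ : OrderPreserving (V G ∩ S) merge r₁
  merge-preserves₁ {x} {y} x∈ y∈ lt =
    ℕₚ.+-cancelʳ-< (r₂ v) (r₁ x) (r₁ y) (ℕₚ.*-cancelˡ-< 2 _ _
      (subst₂ _<_ (merge-S (proj₂ (x∈p∩q⁻ (V G) S x∈))) (merge-S (proj₂ (x∈p∩q⁻ (V G) S y∈))) lt))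

  -- In contrast to `S`, the part `T` mixes parities: a vertex shared with `S` must be `v` and is
  -- even, the others are odd. The shifts make all of them comparable through `r₂`, up to a tie.
  merge-preserves₂ : InjectiveOn (V G ∩ T) r₂ → OrderPreserving (V G ∩ T) merge r₂
  merge-preserves₂ inj {x} {y} x∈ y∈ lt with x ∈? S | y ∈? S
  ... | no _    | no _    = ℕₚ.+-cancelʳ-< (r₁ v) (r₂ x) (r₂ y) (ℕₚ.*-cancelˡ-< 2 _ _ (s<s⁻¹ lt))
  ... | yes x∈S | yes y∈S
    with refl ← meet x∈S (proj₂ (x∈p∩q⁻ (V G) T x∈))
       | refl ← meet y∈S (proj₂ (x∈p∩q⁻ (V G) T y∈)) = contradiction lt (ℕₚ.<-irrefl refl)
  ... | no _    | yes y∈S with refl ← meet y∈S (proj₂ (x∈p∩q⁻ (V G) T y∈)) =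
    ℕₚ.+-cancelʳ-< (r₁ v) (r₂ x) (r₂ v)
      (subst (r₂ x + r₁ v <_) (ℕₚ.+-comm (r₁ v) (r₂ v)) (double< lt))
  ... | yes x∈S | no y∉S with refl ← meet x∈S (proj₂ (x∈p∩q⁻ (V G) T x∈)) =
    -- An odd number above that of `v` yields only `r₂ v ≤ r₂ y`; injectivity of `r₂` excludes
    -- equality, since `y` is outside `S`.
    ℕₚ.≤∧≢⇒< (ℕₚ.+-cancelʳ-≤ (r₁ v) (r₂ v) (r₂ y)
               (subst (_≤ r₂ y + r₁ v) (ℕₚ.+-comm (r₁ v) (r₂ v)) (ℕₚ.*-cancelˡ-≤ 2 (s≤s⁻¹ lt))))
             (λ eq → y∉S (subst (_∈ S) (inj x∈ y∈ eq) x∈S))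

  merge-injective : InjectiveOn (V G ∩ S) r₁ → InjectiveOn (V G ∩ T) r₂ → InjectiveOn (V G) merge
  merge-injective inj₁′ inj₂′ {x} {y} x∈ y∈ eq with x ∈? S | y ∈? S
  ... | yes x∈S | yes y∈S = inj₁′ (x∈p∩q⁺ (x∈ , x∈S)) (x∈p∩q⁺ (y∈ , y∈S))
        (ℕₚ.+-cancelʳ-≡ (r₂ v) (r₁ x) (r₁ y) (ℕₚ.*-cancelˡ-≡ _ _ 2 eq))
  ... | yes _   | no _    = contradiction eq (ℕₚ.even≢odd (r₁ x + r₂ v) (r₂ y + r₁ v))
  ... | no _    | yes _   = contradiction (sym eq) (ℕₚ.even≢odd (r₁ y + r₂ v) (r₂ x + r₁ v))
  ... | no x∉S  | no y∉S  = inj₂′ (x∈p∩q⁺ (x∈ , in-T x∈ x∉S)) (x∈p∩q⁺ (y∈ , in-T y∈ y∉S))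
        (ℕₚ.+-cancelʳ-≡ (r₁ v) (r₂ x) (r₂ y) (ℕₚ.*-cancelˡ-≡ _ _ 2 (ℕₚ.suc-injective eq)))
    where
    in-T : ∀ {z} → z ∈ V G → z ∉ S → z ∈ T
    in-T z∈ z∉S = [ (λ z∈S → contradiction z∈S z∉S) , id ]′ (cover z∈)

altitude-glue : {G : Graph n} (sep : Separation G) → let open Separation sep in
  ∀ {k} → Altitude≤ (induced G S) k → Altitude≤ (induced G T) k → Altitude≤ G k
altitude-glue {G = G} sep {k} (r₁ , inj-S , short-S) (r₂ , inj-T , short-T) =
  merge sep r₁ r₂ , merge-injective sep r₁ r₂ inj-S inj-T , short
  where
  short : Width≤ G (merge sep r₁ r₂) k
  short (u , w , p , closing) with path-ends sep p closing
  ... | inj₁ (u∈ , w∈) = short-S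
        (confine-cycle sep (merge-preserves₁ sep r₁ r₂) u∈ w∈ p closing)
  ... | inj₂ (u∈ , w∈) = short-T
        (confine-cycle (flip sep) (merge-preserves₂ sep r₁ r₂ inj-T) u∈ w∈ p closing)

-- Linear orderings

vertex-≡ : (G : Graph n) {a b : Vertex G} → proj₁ a ≡ proj₁ b → a ≡ b
vertex-≡ G {_ , a∈} {_ , b∈} refl = cong (_ ,_) ([]=-irrelevant a∈ b∈)

module _ (G : Graph n) (U : LinearOrdering G) where

  -- The bridge between orderings and numberings. A numbering is read off an ordering by
  -- `positionOr0`, an ordering is made from a numbering by `sort`; both pairs agree, so one
  -- comparison of cycles serves both directions.
  Agrees : (Fin n → ℕ) → Set
  Agrees r = ∀ {p q} → p Fin.< q → r (vertexAt G U p) < r (vertexAt G U q)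

  position : ∀ {x} → x ∈ V G → Fin (order G)
  position {x} x∈ = proj₁ (Bijection.surjective U (x , x∈))

  vertexAt-position : ∀ {x} (x∈ : x ∈ V G) → vertexAt G U (position x∈) ≡ x
  vertexAt-position {x} x∈ = cong proj₁ (proj₂ (Bijection.surjective U (x , x∈)) refl)

  vertexAt∈ : ∀ p → vertexAt G U p ∈ V G
  vertexAt∈ p = proj₂ (Bijection.to U p)

  vertexAt-injective : Injective _≡_ _≡_ (vertexAt G U)
  vertexAt-injective eq = Bijection.injective U (vertex-≡ G eq)

  positionOr0 : Fin n → ℕ
  positionOr0 x with x ∈? V G
  ... | yes x∈ = toℕ (position x∈)
  -- A dummy value: injectivity is demanded on `V G` only.
  ... | no  _  = 0

  positionOr0-vertexAt : ∀ p → positionOr0 (vertexAt G U p) ≡ toℕ p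
  positionOr0-vertexAt p with vertexAt G U p ∈? V G
  ... | yes x∈ = cong toℕ (vertexAt-injective (vertexAt-position x∈))
  ... | no x∉  = contradiction (vertexAt∈ p) x∉

  positionOr0-agrees : Agrees positionOr0
  positionOr0-agrees {p} {q} =
    subst₂ _<_ (sym (positionOr0-vertexAt p)) (sym (positionOr0-vertexAt q))

  module _ {r : Fin n → ℕ} (agrees : Agrees r) where

    agrees-cancel : ∀ {p q} → r (vertexAt G U p) < r (vertexAt G U q) → p Fin.< q
    agrees-cancel {p} {q} lt with Finₚ.<-cmp p q
    ... | tri< p<q _ _  = p<q
    ... | tri≈ _ refl _ = contradiction lt (ℕₚ.<-irrefl refl)
    ... | tri> _ _ q<p  = contradiction lt (ℕₚ.<-asym (agrees q<p))

    agrees⇒injective : InjectiveOn (V G) r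
    agrees⇒injective x∈ y∈ eq
      with Finₚ.<-cmp (position x∈) (position y∈)
         | trans (cong r (vertexAt-position x∈)) (trans eq (cong r (sym (vertexAt-position y∈))))
    ... | tri< p<q _ _ | eq′ = contradiction eq′ (ℕₚ.<⇒≢ (agrees p<q))
    ... | tri≈ _ p≡q _ | _   =
      trans (sym (vertexAt-position x∈)) (trans (cong (vertexAt G U) p≡q) (vertexAt-position y∈))
    ... | tri> _ _ q<p | eq′ = contradiction (sym eq′) (ℕₚ.<⇒≢ (agrees q<p))

    monotonic⇒cycle : ∀ {m} → HasMonotonicCycle G U (suc m) → Cycle G r m
    monotonic⇒cycle {m} (i , mono) = _ , _ ,
      path-tabulate m (vertexAt G U ∘ i) (vertexAt∈ ∘ i)
        (λ t → adjacent (s≤s (positive t)) t)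
        (λ t → agrees (increasing (s≤s (positive t))
          (ℕₚ.≤-reflexive (cong suc (Finₚ.toℕ-inject₁ t)))))
      , closing ∘ s≤s
      where
      open IsMonotonicCycle mono
      positive : ∀ {k} → Fin k → 0 < k
      positive t = ℕₚ.≤-<-trans z≤n (toℕ<n t)

    cycle⇒monotonic : ∀ {m} → Cycle G r m → HasMonotonicCycle G U (suc m)
    cycle⇒monotonic {m} (u , w , p , closing) = i , record
      { distinct   = λ {s} {t} eq →
          vertex-injective p (trans (sym (at-i s)) (trans eq (at-i t)))
      ; increasing = λ _ {s} {t} s<t → agrees-cancel
          (subst₂ (λ x y → r x < r y) (sym (at-i s)) (sym (at-i t)) (vertex-increasing p s<t))
      ; adjacent   = λ _ t →
          subst₂ (Adj G) (sym (at-i (inject₁ t))) (sym (at-i (suc t))) (vertex-adjacent p t)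
      ; closing    = λ 1<1+m →
          subst₂ (Adj G) (sym (trans (at-i (fromℕ m)) (vertex-last p))) (sym (at-i zero))
            (closing (s≤s⁻¹ 1<1+m))
      }
      where
      i : Fin (suc m) → Fin (order G)
      i t = position (vertex∈ p t)
      at-i : ∀ t → vertexAt G U (i t) ≡ vertex p t
      at-i t = vertexAt-position (vertex∈ p t)

module _ (G : Graph n) {r : Fin n → ℕ} (inj : InjectiveOn (V G) r) where

  private
    place : Fin (order G) → Fin (order G)
    place i = fromℕ< (rank<order G r (element∈ (V G) i))

    toℕ-place : ∀ i → toℕ (place i) ≡ rank G r (element (V G) i)
    toℕ-place i = toℕ-fromℕ< (rank<order G r (element∈ (V G) i))

    place-injective : Injective _≡_ _≡_ place
    place-injective {i} {j} eq = element-injective (V G)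
      (rank-injective G r inj (element∈ (V G) i) (element∈ (V G) j)
        (trans (sym (toℕ-place i)) (trans (cong toℕ eq) (toℕ-place j))))

    -- Ranks send vertices to positions, while an ordering goes the other way. The inverse exists
    -- because an injective self-map of a finite set is onto.
    unplace : Fin (order G) → Fin (order G)
    unplace p = proj₁ (injective⇒surjective place-injective p)

    place-unplace : ∀ p → place (unplace p) ≡ p
    place-unplace p = proj₂ (injective⇒surjective place-injective p)

    at : Fin (order G) → Vertex G
    at p = element (V G) (unplace p) , element∈ (V G) (unplace p)

    at-injective : Injective _≡_ _≡_ at
    at-injective {p} {q} eq = trans (sym (place-unplace p)) (trans
      (cong place (element-injective (V G) (cong proj₁ eq))) (place-unplace q))

    at-surjective : ∀ x → ∃[ p ] at p ≡ x
    at-surjective (x , x∈) =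
      let i , eq = element-surjective (V G) x∈
      in  place i , vertex-≡ G
        (trans (cong (element (V G)) (place-injective (place-unplace (place i)))) eq)

  sort : LinearOrdering G
  sort = mk⤖ (at-injective , λ x → proj₁ (at-surjective x) , λ { refl → proj₂ (at-surjective x) })

  sort-agrees : Agrees G sort r
  sort-agrees {p} {q} p<q = rank-cancel-< G r (subst₂ _<_ (rank-at p) (rank-at q) p<q)
    where
    rank-at : ∀ p → toℕ p ≡ rank G r (proj₁ (at p))
    rank-at p = trans (cong toℕ (sym (place-unplace p))) (toℕ-place (unplace p))

-- Circular altitude

least : ∀ {ℓ} {P : ℕ → Set ℓ} → Decidable P → ∀ k → P k → ∃ (IsMinimum P)
least         P? zero    p = 0 , p , λ _ → z≤n
least {P = P} P? (suc k) p with P? 0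
... | yes p₀ = 0 , p₀ , λ _ → z≤n
... | no ¬p₀ with m , pm , min ← least (P? ∘ suc) k p =
  suc m , pm , λ { {zero} p₀ → contradiction p₀ ¬p₀ ; {suc j} pj → s≤s (min pj) }

least-altitude : (G : Graph n) → ∃ (IsMinimum (Altitude≤ G))
least-altitude {n} G = least (altitude≤? G) n
  -- The search starts from the bound `n`, which any numbering meets.
  (toℕ , (λ _ _ → toℕ-injective) , cycle-length {G = G})

altitude≤-weaken : (G : Graph n) → ∀ {j k} → j ≤ k → Altitude≤ G j → Altitude≤ G k
altitude≤-weaken _ j≤k (r , inj , short) = r , inj , λ c → ℕₚ.<-≤-trans (short c) j≤k

width⇒altitude≤ : (G : Graph n) (U : LinearOrdering G) → ∀ {k} → HasWidth G U k → Altitude≤ G k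
width⇒altitude≤ G U (_ , max) =
    positionOr0 G U , agrees⇒injective G U (positionOr0-agrees G U)
  , λ c → max (cycle⇒monotonic G U (positionOr0-agrees G U) c)

-- A bound on the width becomes the width itself through minimality: if an optimal numbering had no
-- cycle with exactly `suc m` vertices, the bound could be lowered to `m`. The bound 0 fails because
-- a single vertex is a cycle.
least-altitude⇒circular : (G : Graph n) → Nonempty (V G) → ∀ {a} →
                          IsMinimum (Altitude≤ G) a → HasCircularAltitude G a
least-altitude⇒circular G (u , u∈) {zero} ((_ , _ , short) , _) =
  contradiction (short (u , u , single u∈ , λ ())) λ ()
least-altitude⇒circular G _ {suc m} ((r , inj , short) , min) =
    ( sort G inj
    , least-width (sort G inj) (sort-agrees G inj) )
  , λ (U , width) → min (width⇒altitude≤ G U width)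
  where
  attained : Cycle G r m
  attained = decidable-stable (cycle? G r m) λ ¬c →
    ℕₚ.<-irrefl refl (min (r , inj , λ c → ℕₚ.≤∧≢⇒< (s≤s⁻¹ (short c)) λ { refl → ¬c c }))

  least-width : (U : LinearOrdering G) → Agrees G U r → HasWidth G U (suc m)
  least-width U agrees = cycle⇒monotonic G U agrees attained
    , λ { {suc k} c → short (monotonic⇒cycle G U agrees c) }

-- α° is a minimum over exact widths, whereas `Altitude≤` gives only an upper bound. The least such
-- bound is an exact width, so the comparison passes through it.
circular≤ : (G : Graph n) → Nonempty (V G) → ∀ {b k} →
            HasCircularAltitude G b → Altitude≤ G k → b ≤ k
circular≤ G ne (_ , min) alt with a , isMin ← least-altitude G =
  ℕₚ.≤-trans (min (proj₁ (least-altitude⇒circular G ne isMin))) (proj₂ isMin alt)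

-- Blocks

ProperSeparation : Graph n → Set
ProperSeparation G = Σ (Separation G) λ sep → let open Separation sep in
  (∃[ u ] u ∈ V G × u ∈ S × u ∉ T) × (∃[ w ] w ∈ V G × w ∈ T × w ∉ S)

-- K is G itself or G with the cut-vertex v deleted.
separate : (G K : Graph n) (v : Fin n) → K ⊑ G →
  (∀ {x} → x ∈ V G → x ∉ V K → x ≡ v) →
  (∀ {x y} → Adj G x y → x ∈ V K → y ∈ V K → Adj K x y) →
  Disconnection K → ProperSeparation G
separate {n} G K v K⊑G only keep (u , w , u∈ , w∈ , ¬r) = record
    { S     = setOf S?
    ; T     = setOf T?
    ; v     = v
    ; cover = cover
    ; meet  = λ x∈S x∈T → let x∈ , side = ∈-setOf⁻ S? x∈S in
                [ only x∈ , (λ r → contradiction r (∈-setOf⁻ T? x∈T)) ]′ side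
    ; edge  = edge
    }
  , (u , proj₁ K⊑G u∈ , ∈-setOf⁺ S? (proj₁ K⊑G u∈ , inj₂ ε) , λ u∈T → ∈-setOf⁻ T? u∈T ε)
  , (w , proj₁ K⊑G w∈ , ∈-setOf⁺ T? ¬r
       , λ w∈S → [ (λ w∉ → w∉ w∈) , ¬r ]′ (proj₂ (∈-setOf⁻ S? w∈S)))
  where
  open Graph G using (~⇒∈; ~-sym)

  -- `S` is the component of `u` in `K` together with the vertices missing from `K`, and `T` is
  -- whatever `u` does not reach in `K`. A common element is therefore a missing vertex, that is,
  -- `v`.
  S? : Decidable λ x → x ∈ V G × (x ∉ V K ⊎ Reachable K u x)
  S? x = x ∈? V G ×-dec (¬? (x ∈? V K) ⊎-dec reachable? K u x)

  T? : Decidable λ x → ¬ Reachable K u x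
  T? x = ¬? (reachable? K u x)

  cover : ∀ {x} → x ∈ V G → x ∈ setOf S? ⊎ x ∈ setOf T?
  cover {x} x∈ with reachable? K u x
  ... | yes r = inj₁ (∈-setOf⁺ S? (x∈ , inj₂ r))
  ... | no ¬r = inj₂ (∈-setOf⁺ T? ¬r)

  spread : ∀ {x y} → Adj G x y → Reachable K u x → y ∈ setOf S?
  spread {x} {y} e r with y ∈? V K
  ... | no  y∉ = ∈-setOf⁺ S? (~⇒∈ (~-sym e) , inj₁ y∉)
  ... | yes y∈ = ∈-setOf⁺ S? (~⇒∈ (~-sym e) ,
    inj₂ (r ◅◅ return (keep e (reachable⇒∈ K (reverse (Graph.~-sym K) r) u∈) y∈)))

  edge : ∀ {x y} → Adj G x y →
         (x ∈ setOf S? × y ∈ setOf S?) ⊎ (x ∈ setOf T? × y ∈ setOf T?)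
  edge {x} {y} e with reachable? K u x | reachable? K u y
  ... | yes r  | _      = inj₁ (∈-setOf⁺ S? (~⇒∈ e , inj₂ r) , spread e r)
  ... | no _   | yes r  = inj₁ (spread (~-sym e) r , ∈-setOf⁺ S? (~⇒∈ (~-sym e) , inj₂ r))
  ... | no ¬rx | no ¬ry = inj₂ (∈-setOf⁺ T? ¬rx , ∈-setOf⁺ T? ¬ry)

biconnected-or-separation : (G : Graph n) → Biconnected G ⊎ ProperSeparation G
biconnected-or-separation G with biconnected-or-cut G
... | inj₁ b = inj₁ b
-- No vertex is missing here, so the parts are disjoint and any vertex can be named as `v`.
... | inj₂ (inj₁ d@(u , _)) = inj₂ (separate G G u (id , id)
  (λ x∈ x∉ → contradiction x∈ x∉) (λ e _ _ → e) d)
... | inj₂ (inj₂ (v , _ , d)) = inj₂ (separate G (G ∖ v) v (∖-⊑ G v)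
  (λ {x} x∈ x∉ → decidable-stable (x ≟ v) (x∉ ∘ x∈p∧x≢y⇒x∈p-y x∈))
  (λ e x∈ y∈ → e , proj₂ (-∈⁻ (V G) x∈) , proj₂ (-∈⁻ (V G) y∈)) d)

-- H ≼ G says that the circular altitude of H is at most that of G.
infix 4 _≼_

_≼_ : Graph n → Graph n → Set
H ≼ G = ∀ {k} → Altitude≤ G k → Altitude≤ H k

≼-total : (H K : Graph n) → H ≼ K ⊎ K ≼ H
≼-total H K with a , aH , minH ← least-altitude H | b , bK , minK ← least-altitude K
  with ℕₚ.≤-total a b
... | inj₁ a≤b = inj₁ λ alt → altitude≤-weaken H (ℕₚ.≤-trans a≤b (minK alt)) aH
... | inj₂ b≤a = inj₂ λ alt → altitude≤-weaken K (ℕₚ.≤-trans b≤a (minH alt)) bK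

induced-smaller : (G : Graph n) (S : Subset n) → ∃[ x ] (x ∈ V G × x ∉ S) →
                  order (induced G S) < order G
induced-smaller G S (x , x∈ , x∉) = p⊂q⇒∣p∣<∣q∣
  (proj₁ ∘ x∈p∩q⁻ (V G) S , x , x∈ , x∉ ∘ proj₂ ∘ x∈p∩q⁻ (V G) S)

-- Gluing needs the same bound on both parts, so the core of larger altitude is kept: a bound for it
-- also bounds the other core, hence both parts. Each part omits a vertex of `G`, which makes the
-- recursion terminate.
biconnected-core : (G : Graph n) → Nonempty (V G) → Acc _<_ (order G) →
  ∃[ N ] (N ⊑ G × Nonempty (V N) × Biconnected N × G ≼ N)
biconnected-core G ne (acc rec) with biconnected-or-separation G
... | inj₁ b = G , (id , id) , ne , b , id
... | inj₂ (sep , (u , u∈ , u∈S , u∉T) , (w , w∈ , w∈T , w∉S))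
  with N₁ , sub₁ , ne₁ , b₁ , le₁ ← biconnected-core (induced G (Separation.S sep))
         (u , x∈p∩q⁺ (u∈ , u∈S)) (rec (induced-smaller G _ (w , w∈ , w∉S)))
     | N₂ , sub₂ , ne₂ , b₂ , le₂ ← biconnected-core (induced G (Separation.T sep))
         (w , x∈p∩q⁺ (w∈ , w∈T)) (rec (induced-smaller G _ (u , u∈ , u∉T)))
  with ≼-total N₁ N₂
... | inj₁ N₁≼N₂ = N₂ , ⊑-trans N₂ (induced G _) G sub₂ (induced-⊑ G _) , ne₂ , b₂
  , λ alt → altitude-glue sep (le₁ (N₁≼N₂ alt)) (le₂ alt)
... | inj₂ N₂≼N₁ = N₁ , ⊑-trans N₁ (induced G _) G sub₁ (induced-⊑ G _) , ne₁ , b₁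
  , λ alt → altitude-glue sep (le₁ alt) (le₂ (N₂≼N₁ alt))

-- Subsets can be searched exhaustively, whereas a `Graph` carries an arbitrary relation. Vertex
-- sets suffice because adding edges of `G` keeps a subgraph biconnected.
BiconnectedSet : Graph n → Subset n → Set
BiconnectedSet G S = S ⊆ V G × Biconnected (induced G S)

biconnectedSet? : (G : Graph n) → Decidable (BiconnectedSet G)
biconnectedSet? G S = S ⊆? V G ×-dec biconnected? (induced G S)

biconnected⇒set : (H G : Graph n) → H ⊑ G → Biconnected H → BiconnectedSet G (V H)
biconnected⇒set H G H⊑G b = proj₁ H⊑G , biconnected-spanning H (induced G (V H))
  ( (λ x∈ → x∈p∩q⁺ (proj₁ H⊑G x∈ , x∈))
  , λ e → proj₂ H⊑G e , Graph.~⇒∈ H e , Graph.~⇒∈ H (Graph.~-sym H e))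
  (proj₂ ∘ x∈p∩q⁻ (V G) (V H)) b

maximal-extension : (G : Graph n) (S : Subset n) → BiconnectedSet G S → Acc _<_ (n ∸ ∣ S ∣) →
  ∃[ M ] (BiconnectedSet G M × S ⊆ M × (∀ {C} → BiconnectedSet G C → M ⊆ C → C ⊆ M))
maximal-extension {n} G S b (acc rec)
  with anySubset? (λ C → biconnectedSet? G C ×-dec S ⊂? C)
... | yes (C , bC , S⊂C) =
  let M , bM , C⊆M , max = maximal-extension G C bC
        (rec (ℕₚ.∸-monoʳ-< (p⊂q⇒∣p∣<∣q∣ S⊂C) (∣p∣≤n C)))
  in  M , bM , C⊆M ∘ proj₁ S⊂C , max
... | no ¬C = S , b , id , λ {C} bC S⊆C {x} x∈ →
  decidable-stable (x ∈? S) λ x∉ → ¬C (C , bC , S⊆C , x , x∈ , x∉)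

module _ (G : Graph n) {M : Subset n} (M-nonempty : Nonempty M)
         (M-biconnected : BiconnectedSet G M)
         (max : ∀ {C} → BiconnectedSet G C → M ⊆ C → C ⊆ M) where

  -- A competitor `C` need not be induced, but its vertex set is again a biconnected set and so lies
  -- in `M`; its edges are then edges of `G` within `M`.
  maximal⇒block : IsBlock G (induced G M)
  maximal⇒block = record
    { subgraph     = induced-⊑ G M
    ; nonseparable = biconnected⇒nonseparable (induced G M)
        (let x , x∈ = M-nonempty in x , x∈p∩q⁺ (proj₁ M-biconnected x∈ , x∈))
        (proj₂ M-biconnected)
    ; maximal      = λ C C⊑G nonsep B⊑C →
        let C⊆M : V C ⊆ M
            C⊆M = max (biconnected⇒set C G C⊑G (nonseparable⇒biconnected C nonsep))
                      (λ x∈ → proj₁ B⊑C (x∈p∩q⁺ (proj₁ M-biconnected x∈ , x∈)))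
        in  (λ x∈ → x∈p∩q⁺ (proj₁ C⊑G x∈ , C⊆M x∈))
          , λ e → proj₂ C⊑G e , C⊆M (Graph.~⇒∈ C e) , C⊆M (Graph.~⇒∈ C (Graph.~-sym C e))
    }

block-above : (N G : Graph n) → N ⊑ G → Nonempty (V N) → Biconnected N →
              ∃[ B ] (IsBlock G B × N ⊑ B)
block-above N G N⊑G (x , x∈) b
  with M , bM , N⊆M , max ←
         maximal-extension G (V N) (biconnected⇒set N G N⊑G b) (<-wellFounded _) =
    induced G M , maximal⇒block G (x , N⊆M x∈) bM max
  , (λ y∈ → x∈p∩q⁺ (proj₁ N⊑G y∈ , N⊆M y∈))
  , λ e → proj₂ N⊑G e , N⊆M (Graph.~⇒∈ N e) , N⊆M (Graph.~⇒∈ N (Graph.~-sym N e))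

theorem1 : ∀ {n : ℕ} (G : Graph n) → Nonempty (V G) →
    ∃[ a ] (HasCircularAltitude G a × IsMaximum (HasBlockOfAltitude G) a)
theorem1 G ne
  with a , isMin@(aG , minG) ← least-altitude G
     | N , N⊑G , neN , bN , G≼N ← biconnected-core G ne (<-wellFounded _)
  with B , block , N⊑B ← block-above N G N⊑G neN bN =
    a , least-altitude⇒circular G ne isMin
  -- The altitude of `B` is squeezed: `B` is a subgraph of `G`, and any bound for `B` passes to the
  -- core `N` inside it and from there to `G`.
  , (B , block , least-altitude⇒circular B (block-nonempty block)
      ( altitude-mono B G (IsBlock.subgraph block) aG
      , λ alt → minG (G≼N (altitude-mono N B N⊑B alt))))
  , λ (C , block′ , altitude) → circular≤ C (block-nonempty block′) altitude
      (altitude-mono C G (IsBlock.subgraph block′) aG)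
  where
  block-nonempty : ∀ {B} → IsBlock G B → Nonempty (V B)
  block-nonempty block = proj₁ (proj₁ (IsBlock.nonseparable block))
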